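{- For every integer $m\ge 2$, $$\sum_{k=2}^{\infty}\frac{\zeta(k)-1}{k^m}=1-\gamma-\zeta(m)+C_m .$$
   Context: $\zeta$ is the Riemann zeta function and $\gamma$ is Euler's constant. For an integer $m\ge2$, $\operatorname{Li}_m(z)=\sum_{n=1}^{\infty} z^n/n^m$ (for $|z|\le 1$) is the polylogarithm, and $$C_m:=\lim_{n\to\infty}\left(\sum_{k=1}^n \operatorname{Li}_m\!\left(\frac1k\right)-\log n\right).$$ -}

module Defs where

open import Data.Nat.Base as ℕ using (ℕ; zero; suc; 2+; z≤n; s≤s; NonTrivial; nonTrivial⇒n>1)
import Data.Nat.Properties as ℕ
open import Data.Integer.Base as ℤ using (+_)
import Data.Integer.Properties as ℤ
open import Data.Rational.Base as ℚ using (ℚ; 0ℚ; 1ℚ; ½)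
import Data.Rational.Properties as ℚ
import Data.Rational.Unnormalised.Base as ℚᵘ
import Data.Rational.Unnormalised.Properties as ℚᵘ
open import Data.Product.Base using (∃; _×_; _,_; proj₁; proj₂)
open import Data.Sum.Base using (_⊎_; inj₁; inj₂)
open import Relation.Binary.PropositionalEquality
  using (_≡_; refl; sym; trans; cong; cong₂; subst; subst₂; module ≡-Reasoning)

module RationalSequences where

  open import Data.Rational.Base using (_+_; _*_; _-_; -_; _≤_; _<_; ∣_∣)
  open import Data.Rational.Solver using (module +-*-Solver)
  open +-*-Solver using (solve; _:=_; _:+_; _:*_; _:-_; :-_; con)

  IsCauchy : (ℕ → ℚ) → Set
  IsCauchy a = ∀ ε → 0ℚ < ε → ∃ λ N → ∀ m n → N ℕ.≤ m → N ℕ.≤ n → ∣ a m - a n ∣ < ε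

  ∑ : (ℕ → ℚ) → ℕ → ℚ
  ∑ f zero    = 0ℚ
  ∑ f (suc n) = ∑ f n + f n

  infixr 8 _^_
  _^_ : ℚ → ℕ → ℚ
  q ^ zero  = 1ℚ
  q ^ suc n = q * q ^ n

  ι : ℕ → ℚ
  ι n = + n ℚ./ 1

  recip : (n : ℕ) .{{_ : ℕ.NonZero n}} → ℚ
  recip n = + 1 ℚ./ n

  recip^ : (n s : ℕ) .{{_ : ℕ.NonZero n}} → ℚ
  recip^ n s = recip (n ℕ.^ s) {{ℕ.m^n≢0 n s}}

  H : ℕ → ℚ
  H = ∑ (λ j → recip (suc j))

  -- Partial sums over n = j + 1 = 1, …, N + 1 of Σ 1/nˢ and of Σ zⁿ/nˢ.
  ζ-approx : ℕ → ℕ → ℚ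
  ζ-approx s N = ∑ (λ j → recip^ (suc j) s) (suc N)

  Li-approx : ℕ → ℚ → ℕ → ℚ
  Li-approx s z N = ∑ (λ j → z ^ suc j * recip^ (suc j) s) (suc N)

  -- Right-endpoint Riemann sum of ∫₁ⁿ dt/t for the partition of [1,n] into intervals
  -- of length 1/M, M = N + 1:  the value of 1/t at t = 1 + (j+1)/M is M/(M + (j+1)).
  log-approx : ℕ → ℕ → ℚ
  log-approx n N = ∑ (λ j → recip M * (+ M ℚ./ (M ℕ.+ suc j))) ((n ℕ.∸ 1) ℕ.* M)
    where M = suc N

  0≤q-p⇒p≤q : ∀ {p q} → 0ℚ ≤ q - p → p ≤ q
  0≤q-p⇒p≤q {p} {q} h = subst₂ _≤_ (ℚ.+-identityˡ p)
    (solve 2 (λ p q → (q :- p) :+ p := q) refl p q) (ℚ.+-monoˡ-≤ p h)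

  p≤q⇒0≤q-p : ∀ {p q} → p ≤ q → 0ℚ ≤ q - p
  p≤q⇒0≤q-p {p} {q} h = subst (_≤ q - p) (ℚ.+-inverseʳ p) (ℚ.+-monoˡ-≤ (- p) h)

  p<q⇒0<q-p : ∀ {p q} → p < q → 0ℚ < q - p
  p<q⇒0<q-p {p} {q} h = subst (_< q - p) (ℚ.+-inverseʳ p) (ℚ.+-monoˡ-< (- p) h)

  0≤+ : ∀ {p q} → 0ℚ ≤ p → 0ℚ ≤ q → 0ℚ ≤ p + q
  0≤+ {p} {q} hp hq = subst (_≤ p + q) (ℚ.+-identityʳ 0ℚ) (ℚ.+-mono-≤ hp hq)

  0≤* : ∀ {p q} → 0ℚ ≤ p → 0ℚ ≤ q → 0ℚ ≤ p * q
  0≤* {p} {q} hp hq = subst (_≤ p * q) (ℚ.*-zeroˡ q)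
    (ℚ.*-monoʳ-≤-nonNeg q {{ℚ.nonNegative hq}} hp)

  *-mono-≤ : ∀ {p q r s} → 0ℚ ≤ p → 0ℚ ≤ s → p ≤ q → r ≤ s → p * r ≤ q * s
  *-mono-≤ {p} {q} {r} {s} 0≤p 0≤s p≤q r≤s = ℚ.≤-trans
    (ℚ.*-monoˡ-≤-nonNeg p {{ℚ.nonNegative 0≤p}} r≤s)
    (ℚ.*-monoʳ-≤-nonNeg s {{ℚ.nonNegative 0≤s}} p≤q)

  p≤∣p∣ : ∀ p → p ≤ ∣ p ∣
  p≤∣p∣ p with ℚ.≤-total 0ℚ p
  ... | inj₁ 0≤p = ℚ.≤-reflexive (sym (ℚ.0≤p⇒∣p∣≡p 0≤p))
  ... | inj₂ p≤0 = ℚ.≤-trans p≤0 (ℚ.0≤∣p∣ p)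

  ∣∣≤ : ∀ {p q} → p ≤ q → - p ≤ q → ∣ p ∣ ≤ q
  ∣∣≤ {p} {q} h₁ h₂ with ℚ.∣p∣≡p∨∣p∣≡-p p
  ... | inj₁ eq = subst (_≤ q) (sym eq) h₁
  ... | inj₂ eq = subst (_≤ q) (sym eq) h₂

  ∣-∣-sym : ∀ p q → ∣ p - q ∣ ≡ ∣ q - p ∣
  ∣-∣-sym p q = trans (cong ∣_∣ (solve 2 (λ p q → p :- q := :- (q :- p)) refl p q))
                      (ℚ.∣-p∣≡∣p∣ (q - p))

  ∣-∣-triangle : ∀ p q r → ∣ p - r ∣ ≤ ∣ p - q ∣ + ∣ q - r ∣
  ∣-∣-triangle p q r = subst (λ t → ∣ t ∣ ≤ ∣ p - q ∣ + ∣ q - r ∣)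
    (solve 3 (λ p q r → (p :- q) :+ (q :- r) := p :- r) refl p q r)
    (ℚ.∣p+q∣≤∣p∣+∣q∣ (p - q) (q - r))

  ∣p-p∣≡0 : ∀ p → ∣ p - p ∣ ≡ 0ℚ
  ∣p-p∣≡0 p = cong ∣_∣ (ℚ.+-inverseʳ p)

  ∣∣p∣-∣q∣∣≤∣p-q∣ : ∀ p q → ∣ ∣ p ∣ - ∣ q ∣ ∣ ≤ ∣ p - q ∣
  ∣∣p∣-∣q∣∣≤∣p-q∣ p q = ∣∣≤ (half p q)
    (subst₂ _≤_ (solve 2 (λ p q → q :- p := :- (p :- q)) refl ∣ p ∣ ∣ q ∣) (∣-∣-sym q p) (half q p))
    where
    half : ∀ p q → ∣ p ∣ - ∣ q ∣ ≤ ∣ p - q ∣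
    half p q = subst (∣ p ∣ - ∣ q ∣ ≤_)
      (solve 2 (λ x y → (x :+ y) :- y := x) refl (∣ p - q ∣) ∣ q ∣)
      (ℚ.+-monoˡ-≤ (- ∣ q ∣) (subst (λ t → ∣ t ∣ ≤ ∣ p - q ∣ + ∣ q ∣)
        (solve 2 (λ p q → (p :- q) :+ q := p) refl p q) (ℚ.∣p+q∣≤∣p∣+∣q∣ (p - q) q)))

  ½-pos : ∀ {ε} → 0ℚ < ε → 0ℚ < ½ * ε
  ½-pos {ε} 0<ε = subst (_< ½ * ε) (ℚ.*-zeroʳ ½) (ℚ.*-monoʳ-<-pos ½ 0<ε)

  ½+½ : ∀ ε → ½ * ε + ½ * ε ≡ ε
  ½+½ ε = trans (sym (ℚ.*-distribʳ-+ ε ½ ½)) (ℚ.*-identityˡ ε)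

  toℚᵘ-/ : ∀ k n .{{_ : ℕ.NonZero n}} → ℚ.toℚᵘ (+ k ℚ./ n) ℚᵘ.≃ (+ k ℚᵘ./ n)
  toℚᵘ-/ k (suc n) = ℚ.toℚᵘ-fromℚᵘ (ℚᵘ.mkℚᵘ (+ k) n)

  recip-* : ∀ m n .{{_ : ℕ.NonZero m}} .{{_ : ℕ.NonZero n}} →
            recip (m ℕ.* n) {{ℕ.m*n≢0 m n}} ≡ recip m * recip n
  recip-* m@(suc _) n@(suc _) = ℚ.toℚᵘ-injective (ℚᵘ.≃-trans (toℚᵘ-/ 1 (m ℕ.* n))
    (ℚᵘ.≃-sym (ℚᵘ.≃-trans (ℚ.toℚᵘ-homo-* (recip m) (recip n))
      (ℚᵘ.*-cong (toℚᵘ-/ 1 m) (toℚᵘ-/ 1 n)))))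

  /≡ι*recip : ∀ k n .{{_ : ℕ.NonZero n}} → + k ℚ./ n ≡ ι k * recip n
  /≡ι*recip k n@(suc _) = ℚ.toℚᵘ-injective (ℚᵘ.≃-trans (toℚᵘ-/ k n)
    (ℚᵘ.≃-sym (ℚᵘ.≃-trans (ℚ.toℚᵘ-homo-* (ι k) (recip n))
      (ℚᵘ.≃-trans (ℚᵘ.*-cong (toℚᵘ-/ k 1) (toℚᵘ-/ 1 n))
        (ℚᵘ.*≡* (cong₂ ℤ._*_ (ℤ.*-identityʳ (+ k)) (cong +_ (sym (ℕ.*-identityˡ n)))))))))

  ι-suc : ∀ n → ι (suc n) ≡ 1ℚ + ι n
  ι-suc n = ℚ.toℚᵘ-injective (ℚᵘ.≃-trans (toℚᵘ-/ (suc n) 1)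
    (ℚᵘ.≃-sym (ℚᵘ.≃-trans (ℚ.toℚᵘ-homo-+ 1ℚ (ι n))
      (ℚᵘ.≃-trans (ℚᵘ.+-congʳ (ℚ.toℚᵘ 1ℚ) (toℚᵘ-/ n 1))
        (ℚᵘ.*≡* (cong (ℤ._* + 1) (cong (λ t → + 1 ℤ.+ t) (ℤ.*-identityʳ (+ n)))))))))

  ι*recip : ∀ n .{{_ : ℕ.NonZero n}} → ι n * recip n ≡ 1ℚ
  ι*recip n@(suc _) = trans (sym (/≡ι*recip n n)) (ℚ.toℚᵘ-injective
    (ℚᵘ.≃-trans (toℚᵘ-/ n n) (ℚᵘ.*≡* (ℤ.*-comm (+ n) (+ 1)))))

  recip-antitone : ∀ {m n} .{{_ : ℕ.NonZero m}} .{{_ : ℕ.NonZero n}} →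
                   m ℕ.≤ n → recip n ≤ recip m
  recip-antitone {m@(suc _)} {n@(suc _)} m≤n = ℚ.toℚᵘ-cancel-≤
    (ℚᵘ.≤-respˡ-≃ (ℚᵘ.≃-sym (toℚᵘ-/ 1 n)) (ℚᵘ.≤-respʳ-≃ (ℚᵘ.≃-sym (toℚᵘ-/ 1 m))
      (ℚᵘ.*≤* (ℤ.*-monoˡ-≤-nonNeg (+ 1) (ℤ.+≤+ m≤n)))))

  recip>0 : ∀ n .{{_ : ℕ.NonZero n}} → 0ℚ < recip n
  recip>0 n = ℚ.positive⁻¹ (recip n) {{ℚ.normalize-pos 1 n}}

  recip≥0 : ∀ n .{{_ : ℕ.NonZero n}} → 0ℚ ≤ recip n
  recip≥0 n = ℚ.<⇒≤ (recip>0 n)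

  recip^≥0 : ∀ N s → 0ℚ ≤ recip^ (2+ N) s
  recip^≥0 N s = recip≥0 (2+ N ℕ.^ s) {{ℕ.m^n≢0 (2+ N) s}}

  ∣recip∣≤1 : ∀ n .{{_ : ℕ.NonZero n}} → ∣ recip n ∣ ≤ 1ℚ
  ∣recip∣≤1 n@(suc _) = subst (_≤ 1ℚ) (sym (ℚ.0≤p⇒∣p∣≡p (recip≥0 n)))
    (recip-antitone {1} {n} (s≤s z≤n))

  ι*recip-* : ∀ k n .{{_ : ℕ.NonZero k}} .{{_ : ℕ.NonZero n}} →
              ι k * recip (n ℕ.* k) {{ℕ.m*n≢0 n k}} ≡ recip n
  ι*recip-* k n = begin
    ι k * recip (n ℕ.* k) {{ℕ.m*n≢0 n k}} ≡⟨ cong (ι k *_) (recip-* n k) ⟩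
    ι k * (recip n * recip k)
      ≡⟨ solve 3 (λ a b c → a :* (b :* c) := b :* (a :* c)) refl (ι k) (recip n) (recip k) ⟩
    recip n * (ι k * recip k)             ≡⟨ cong (recip n *_) (ι*recip k) ⟩
    recip n * 1ℚ                          ≡⟨ ℚ.*-identityʳ (recip n) ⟩
    recip n                               ∎
    where open ≡-Reasoning

  gap : ℕ → ℚ
  gap n = recip (suc n) - recip (2+ n)

  gap≡* : ∀ n → gap n ≡ recip (suc n) * recip (2+ n)
  gap≡* n = begin
    a - b                           ≡⟨ cong₂ _-_ (sym (ℚ.*-identityʳ a)) (sym (ℚ.*-identityʳ b)) ⟩
    a * 1ℚ - b * 1ℚ                 ≡⟨ cong₂ (λ s t → a * s - b * t)
                                         (sym (trans (cong (_* b) (sym (ι-suc (suc n)))) (ι*recip (2+ n))))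
                                         (sym (ι*recip (suc n))) ⟩
    a * ((1ℚ + x) * b) - b * (x * a) ≡⟨ solve 3 (λ a b x →
                                         a :* ((con 1ℚ :+ x) :* b) :- b :* (x :* a) := a :* b) refl a b x ⟩
    a * b                           ∎
    where
    open ≡-Reasoning
    a = recip (suc n)
    b = recip (2+ n)
    x = ι (suc n)

  gap≥0 : ∀ n → 0ℚ ≤ gap n
  gap≥0 n = p≤q⇒0≤q-p (recip-antitone {suc n} {2+ n} (ℕ.n≤1+n (suc n)))

  recip-^≤gap : ∀ n s .{{_ : NonTrivial s}} → recip^ (2+ n) s ≤ gap n
  recip-^≤gap n s = subst (recip^ (2+ n) s ≤_)
    (trans (recip-* (suc n) (2+ n)) (sym (gap≡* n)))
    (recip-antitone {suc n ℕ.* 2+ n} {2+ n ℕ.^ s} {{_}} {{ℕ.m^n≢0 (2+ n) s}} (ℕ.≤-trans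
      (ℕ.*-mono-≤ (ℕ.n≤1+n (suc n)) (ℕ.≤-reflexive (sym (ℕ.*-identityʳ (2+ n)))))
      (ℕ.^-monoʳ-≤ (2+ n) (nonTrivial⇒n>1 s))))

  archimedean : ∀ ε → 0ℚ < ε → ∃ λ N → recip (suc N) < ε
  archimedean ε 0<ε with ε | ℚ.positive 0<ε
  ... | ε@(ℚ.mkℚ (+ suc p) d _) | _ = suc d , ℚ.toℚᵘ-cancel-<
    (ℚᵘ.<-respˡ-≃ (ℚᵘ.≃-sym (toℚᵘ-/ 1 (2+ d)))
      (ℚᵘ.*<* (ℤ.+<+ (s≤s (ℕ.≤-trans (ℕ.≤-reflexive (ℕ.+-identityʳ (suc d)))
        (ℕ.m≤m+n (suc d) (p ℕ.* 2+ d)))))))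

  Steps : (ℕ → ℚ) → Set
  Steps a = ∀ n → ∣ a (suc n) - a n ∣ ≤ gap n

  telescope : ∀ a → Steps a → ∀ N k → ∣ a (k ℕ.+ N) - a N ∣ ≤ recip (suc N) - recip (suc (k ℕ.+ N))
  telescope a st N zero    = ℚ.≤-reflexive
    (trans (∣p-p∣≡0 (a N)) (sym (ℚ.+-inverseʳ (recip (suc N)))))
  telescope a st N (suc k) = begin
    ∣ a (suc (k ℕ.+ N)) - a N ∣
      ≤⟨ ∣-∣-triangle (a (suc (k ℕ.+ N))) (a (k ℕ.+ N)) (a N) ⟩
    ∣ a (suc (k ℕ.+ N)) - a (k ℕ.+ N) ∣ + ∣ a (k ℕ.+ N) - a N ∣
      ≤⟨ ℚ.+-mono-≤ (st (k ℕ.+ N)) (telescope a st N k) ⟩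
    (r - r′) + (recip (suc N) - r)
      ≡⟨ solve 3 (λ x y z → (x :- y) :+ (z :- x) := z :- y) refl r r′ (recip (suc N)) ⟩
    recip (suc N) - r′ ∎
    where
    open ℚ.≤-Reasoning
    r  = recip (suc (k ℕ.+ N))
    r′ = recip (2+ (k ℕ.+ N))

  steps-bound≤ : ∀ a → Steps a → ∀ {N} m n → N ℕ.≤ m → m ℕ.≤ n → ∣ a n - a m ∣ ≤ recip (suc N)
  steps-bound≤ a st {N} m n N≤m m≤n =
    subst (λ t → ∣ a t - a m ∣ ≤ recip (suc N)) (ℕ.m∸n+n≡m m≤n) (begin
      ∣ a (k ℕ.+ m) - a m ∣                  ≤⟨ telescope a st m k ⟩
      recip (suc m) - recip (suc (k ℕ.+ m))  ≤⟨ ℚ.+-monoʳ-≤ (recip (suc m))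
                                                  (ℚ.neg-antimono-≤ (recip≥0 (suc (k ℕ.+ m)))) ⟩
      recip (suc m) + 0ℚ                     ≡⟨ ℚ.+-identityʳ (recip (suc m)) ⟩
      recip (suc m)                          ≤⟨ recip-antitone {suc N} {suc m} (s≤s N≤m) ⟩
      recip (suc N)                          ∎)
    where
    open ℚ.≤-Reasoning
    k = n ℕ.∸ m

  steps-bound : ∀ a → Steps a → ∀ {N} m n → N ℕ.≤ m → N ℕ.≤ n → ∣ a m - a n ∣ ≤ recip (suc N)
  steps-bound a st {N} m n N≤m N≤n with ℕ.≤-total m n
  ... | inj₁ m≤n = subst (_≤ recip (suc N)) (∣-∣-sym (a n) (a m)) (steps-bound≤ a st m n N≤m m≤n)
  ... | inj₂ n≤m = steps-bound≤ a st n m N≤n n≤m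

  steps⇒cauchy : ∀ a → Steps a → IsCauchy a
  steps⇒cauchy a st ε 0<ε = N , λ m n N≤m N≤n →
    ℚ.≤-<-trans (steps-bound a st m n N≤m N≤n) (proj₂ (archimedean ε 0<ε))
    where N = proj₁ (archimedean ε 0<ε)

  cauchy-mono : ∀ a b → IsCauchy a → (∀ m n → ∣ b m - b n ∣ ≤ ∣ a m - a n ∣) → IsCauchy b
  cauchy-mono a b ca b≤a ε 0<ε with ca ε 0<ε
  ... | N , h = N , λ m n N≤m N≤n → ℚ.≤-<-trans (b≤a m n) (h m n N≤m N≤n)

  cauchy-const : ∀ q → IsCauchy (λ _ → q)
  cauchy-const q ε 0<ε = 0 , λ _ _ _ _ → subst (_< ε) (sym (∣p-p∣≡0 q)) 0<ε

  cauchy-+ : ∀ a b → IsCauchy a → IsCauchy b → IsCauchy (λ n → a n + b n)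
  cauchy-+ a b ca cb ε 0<ε with ca (½ * ε) (½-pos 0<ε) | cb (½ * ε) (½-pos 0<ε)
  ... | M , hM | N , hN = M ℕ.⊔ N , λ m n M⊔N≤m M⊔N≤n → ℚ.≤-<-trans
    (subst (λ t → ∣ t ∣ ≤ ∣ a m - a n ∣ + ∣ b m - b n ∣)
      (solve 4 (λ p q r s → (p :- q) :+ (r :- s) := (p :+ r) :- (q :+ s)) refl (a m) (a n) (b m) (b n))
      (ℚ.∣p+q∣≤∣p∣+∣q∣ (a m - a n) (b m - b n)))
    (subst (∣ a m - a n ∣ + ∣ b m - b n ∣ <_) (½+½ ε) (ℚ.+-mono-<
      (hM m n (ℕ.m⊔n≤o⇒m≤o M N M⊔N≤m) (ℕ.m⊔n≤o⇒m≤o M N M⊔N≤n))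
      (hN m n (ℕ.m⊔n≤o⇒n≤o M N M⊔N≤m) (ℕ.m⊔n≤o⇒n≤o M N M⊔N≤n))))

  cauchy-neg : ∀ a → IsCauchy a → IsCauchy (λ n → - a n)
  cauchy-neg a ca = cauchy-mono a (λ n → - a n) ca λ m n → ℚ.≤-reflexive
    (trans (cong ∣_∣ (solve 2 (λ p q → (:- p) :- (:- q) := :- (p :- q)) refl (a m) (a n)))
           (ℚ.∣-p∣≡∣p∣ (a m - a n)))

  cauchy-abs : ∀ a → IsCauchy a → IsCauchy (λ n → ∣ a n ∣)
  cauchy-abs a ca = cauchy-mono a (λ n → ∣ a n ∣) ca λ m n → ∣∣p∣-∣q∣∣≤∣p-q∣ (a m) (a n)

  cauchy-/ : ∀ a → IsCauchy a → ∀ d .{{_ : ℕ.NonZero d}} → IsCauchy (λ n → a n * recip d)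
  cauchy-/ a ca d = cauchy-mono a (λ n → a n * recip d) ca λ m n → begin
    ∣ a m * recip d - a n * recip d ∣ ≡⟨ cong ∣_∣ (solve 3 (λ p q r → p :* r :- q :* r := (p :- q) :* r)
                                           refl (a m) (a n) (recip d)) ⟩
    ∣ (a m - a n) * recip d ∣         ≡⟨ ℚ.∣p*q∣≡∣p∣*∣q∣ (a m - a n) (recip d) ⟩
    ∣ a m - a n ∣ * ∣ recip d ∣       ≤⟨ ℚ.*-monoˡ-≤-nonNeg ∣ a m - a n ∣ {{ℚ.∣-∣-nonNeg (a m - a n)}}
                                           (∣recip∣≤1 d) ⟩
    ∣ a m - a n ∣ * 1ℚ                ≡⟨ ℚ.*-identityʳ ∣ a m - a n ∣ ⟩
    ∣ a m - a n ∣                     ∎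
    where open ℚ.≤-Reasoning

  ∣∑-step∣ : ∀ f n → ∣ ∑ f (suc n) - ∑ f n ∣ ≡ ∣ f n ∣
  ∣∑-step∣ f n = cong ∣_∣ (solve 2 (λ s t → (s :+ t) :- s := t) refl (∑ f n) (f n))

  ζ-steps : ∀ s .{{_ : NonTrivial s}} → Steps (ζ-approx s)
  ζ-steps s N = subst (_≤ gap N)
    (sym (trans (∣∑-step∣ (λ j → recip^ (suc j) s) (suc N)) (ℚ.0≤p⇒∣p∣≡p (recip^≥0 N s))))
    (recip-^≤gap N s)

  ∣q^n∣≤1 : ∀ {q} → ∣ q ∣ ≤ 1ℚ → ∀ n → ∣ q ^ n ∣ ≤ 1ℚ
  ∣q^n∣≤1 h zero    = ℚ.≤-refl
  ∣q^n∣≤1 {q} h (suc n) = subst (_≤ 1ℚ) (sym (ℚ.∣p*q∣≡∣p∣*∣q∣ q (q ^ n)))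
    (*-mono-≤ (ℚ.0≤∣p∣ q) (ℚ.<⇒≤ (recip>0 1)) h (∣q^n∣≤1 h n))

  Li-steps : ∀ s z .{{_ : NonTrivial s}} → ∣ z ∣ ≤ 1ℚ → Steps (Li-approx s z)
  Li-steps s z ∣z∣≤1 N = begin
    ∣ Li-approx s z (suc N) - Li-approx s z N ∣
      ≡⟨ ∣∑-step∣ (λ j → z ^ suc j * recip^ (suc j) s) (suc N) ⟩
    ∣ z ^ 2+ N * r ∣     ≡⟨ ℚ.∣p*q∣≡∣p∣*∣q∣ (z ^ 2+ N) r ⟩
    ∣ z ^ 2+ N ∣ * ∣ r ∣ ≤⟨ ℚ.*-monoʳ-≤-nonNeg ∣ r ∣ {{ℚ.∣-∣-nonNeg r}} (∣q^n∣≤1 ∣z∣≤1 (2+ N)) ⟩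
    1ℚ * ∣ r ∣           ≡⟨ ℚ.*-identityˡ ∣ r ∣ ⟩
    ∣ r ∣                ≡⟨ ℚ.0≤p⇒∣p∣≡p (recip^≥0 N s) ⟩
    r                    ≤⟨ recip-^≤gap N s ⟩
    gap N                ∎
    where
    open ℚ.≤-Reasoning
    r = recip^ (2+ N) s

  ∑-block : ∀ f l a → ∑ f (l ℕ.+ a) - ∑ f a ≡ ∑ (λ j → f (j ℕ.+ a)) l
  ∑-block f zero    a = ℚ.+-inverseʳ (∑ f a)
  ∑-block f (suc l) a = trans
    (solve 3 (λ x y z → (x :+ y) :- z := (x :- z) :+ y) refl (∑ f (l ℕ.+ a)) (f (l ℕ.+ a)) (∑ f a))
    (cong (_+ f (l ℕ.+ a)) (∑-block f l a))

  ∑-cong : ∀ {f g} → (∀ j → f j ≡ g j) → ∀ n → ∑ f n ≡ ∑ g n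
  ∑-cong h zero    = refl
  ∑-cong h (suc n) = cong₂ _+_ (∑-cong h n) (h n)

  ι-suc-* : ∀ l c → ι (suc l) * c ≡ ι l * c + c
  ι-suc-* l c = trans (cong (_* c) (ι-suc l))
    (solve 2 (λ x c → (con 1ℚ :+ x) :* c := x :* c :+ c) refl (ι l) c)

  ∑-lower : ∀ {f c} l → (∀ j → j ℕ.< l → c ≤ f j) → ι l * c ≤ ∑ f l
  ∑-lower {f} {c} zero    h = ℚ.≤-reflexive (ℚ.*-zeroˡ c)
  ∑-lower {f} {c} (suc l) h = subst (_≤ ∑ f (suc l)) (sym (ι-suc-* l c))
    (ℚ.+-mono-≤ (∑-lower l (λ j j<l → h j (ℕ.m<n⇒m<1+n j<l))) (h l ℕ.≤-refl))

  ∑-upper : ∀ {f c} l → (∀ j → j ℕ.< l → f j ≤ c) → ∑ f l ≤ ι l * c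
  ∑-upper {f} {c} zero    h = ℚ.≤-reflexive (sym (ℚ.*-zeroˡ c))
  ∑-upper {f} {c} (suc l) h = subst (∑ f (suc l) ≤_) (sym (ι-suc-* l c))
    (ℚ.+-mono-≤ (∑-upper l (λ j j<l → h j (ℕ.m<n⇒m<1+n j<l))) (h l ℕ.≤-refl))

  H-block-lower : ∀ l n .{{_ : ℕ.NonZero l}} .{{_ : ℕ.NonZero n}} →
                  recip (suc n) ≤ H (l ℕ.+ n ℕ.* l) - H (n ℕ.* l)
  H-block-lower l@(suc _) n = begin
    recip (suc n)                     ≡⟨ sym (ι*recip-* l (suc n)) ⟩
    ι l * recip (suc n ℕ.* l)         ≤⟨ ∑-lower l (λ j j<l → recip-antitone {suc (j ℕ.+ n ℕ.* l)} {suc n ℕ.* l}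
                                           (ℕ.+-monoˡ-≤ (n ℕ.* l) j<l)) ⟩
    ∑ (λ j → recip (suc (j ℕ.+ n ℕ.* l))) l ≡⟨ sym (∑-block (λ j → recip (suc j)) l (n ℕ.* l)) ⟩
    H (l ℕ.+ n ℕ.* l) - H (n ℕ.* l)   ∎
    where open ℚ.≤-Reasoning

  H-block-upper : ∀ l n .{{_ : ℕ.NonZero l}} .{{_ : ℕ.NonZero n}} →
                  H (l ℕ.+ n ℕ.* l) - H (n ℕ.* l) ≤ recip n
  H-block-upper l@(suc _) n@(suc _) = begin
    H (l ℕ.+ n ℕ.* l) - H (n ℕ.* l)   ≡⟨ ∑-block (λ j → recip (suc j)) l (n ℕ.* l) ⟩
    ∑ (λ j → recip (suc (j ℕ.+ n ℕ.* l))) l ≤⟨ ∑-upper l (λ j _ → recip-antitone {n ℕ.* l} {suc (j ℕ.+ n ℕ.* l)}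
                                           (ℕ.m≤n⇒m≤1+n (ℕ.m≤n+m (n ℕ.* l) j))) ⟩
    ι l * recip (n ℕ.* l)             ≡⟨ ι*recip-* l n ⟩
    recip n                           ∎
    where open ℚ.≤-Reasoning

  log-approx≡ : ∀ n N → log-approx (suc n) N ≡ H (suc n ℕ.* suc N) - H (suc N)
  log-approx≡ n N = begin
    log-approx (suc n) N                        ≡⟨ ∑-cong term (n ℕ.* M) ⟩
    ∑ (λ j → recip (suc (j ℕ.+ M))) (n ℕ.* M)   ≡⟨ sym (∑-block (λ j → recip (suc j)) (n ℕ.* M) M) ⟩
    H (n ℕ.* M ℕ.+ M) - H M                     ≡⟨ cong (λ t → H t - H M) (ℕ.+-comm (n ℕ.* M) M) ⟩
    H (suc n ℕ.* M) - H M                       ∎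
    where
    open ≡-Reasoning
    M = suc N
    recip-cong : ∀ {a b} .{{_ : ℕ.NonZero a}} .{{_ : ℕ.NonZero b}} → a ≡ b → recip a ≡ recip b
    recip-cong refl = refl
    term : ∀ j → recip M * (+ M ℚ./ (M ℕ.+ suc j)) ≡ recip (suc (j ℕ.+ M))
    term j = begin
      recip M * (+ M ℚ./ k)   ≡⟨ cong (recip M *_) (/≡ι*recip M k) ⟩
      recip M * (ι M * recip k) ≡⟨ solve 3 (λ a b c → a :* (b :* c) := (b :* a) :* c) refl
                                   (recip M) (ι M) (recip k) ⟩
      (ι M * recip M) * recip k ≡⟨ cong (_* recip k) (ι*recip M) ⟩
      1ℚ * recip k            ≡⟨ ℚ.*-identityˡ (recip k) ⟩
      recip k                 ≡⟨ recip-cong {k} (ℕ.+-comm M (suc j)) ⟩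
      recip (suc (j ℕ.+ M))   ∎
      where k = M ℕ.+ suc j

  log-steps : ∀ n .{{_ : ℕ.NonZero n}} → Steps (log-approx n)
  log-steps n@(suc n-1) N = begin
    ∣ log-approx n (suc N) - log-approx n N ∣
      ≡⟨ cong ∣_∣ eq ⟩
    ∣ block - r′ ∣
      ≤⟨ ∣∣≤ (ℚ.+-monoˡ-≤ (- r′) upper)
             (ℚ.≤-trans (subst (_≤ 0ℚ) (solve 2 (λ b r → r :- b := :- (b :- r)) refl block r′)
                          (subst (r′ - block ≤_) (ℚ.+-inverseʳ block) (ℚ.+-monoˡ-≤ (- block) lower)))
                        (gap≥0 N)) ⟩
    gap N ∎
    where
    open ℚ.≤-Reasoning
    M  = suc N
    r′ = recip (suc M)
    block = H (n ℕ.+ M ℕ.* n) - H (M ℕ.* n)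
    lower : r′ ≤ block
    lower = H-block-lower n M
    upper : block ≤ recip M
    upper = H-block-upper n M
    eq : log-approx n (suc N) - log-approx n N ≡ block - r′
    eq = begin-equality
      log-approx n (suc N) - log-approx n N
        ≡⟨ cong₂ _-_ (log-approx≡ n-1 (suc N)) (log-approx≡ n-1 N) ⟩
      (H (n ℕ.* suc M) - (H M + r′)) - (H (n ℕ.* M) - H M)
        ≡⟨ cong₂ (λ s t → (H s - (H M + r′)) - (H t - H M)) (ℕ.*-comm n (suc M)) (ℕ.*-comm n M) ⟩
      (H (suc M ℕ.* n) - (H M + r′)) - (H (M ℕ.* n) - H M)
        ≡⟨ solve 4 (λ x h r y → (x :- (h :+ r)) :- (y :- h) := (x :- y) :- r) refl
             (H (suc M ℕ.* n)) (H M) r′ (H (M ℕ.* n)) ⟩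
      block - r′ ∎

  log-increment : ∀ n N → log-approx (2+ n) N - log-approx (suc n) N
                        ≡ H (suc N ℕ.+ suc n ℕ.* suc N) - H (suc n ℕ.* suc N)
  log-increment n N = trans (cong₂ _-_ (log-approx≡ (suc n) N) (log-approx≡ n N))
    (solve 3 (λ x y h → (x :- h) :- (y :- h) := x :- y) refl
      (H (2+ n ℕ.* suc N)) (H (suc n ℕ.* suc N)) (H (suc N)))

  log-increment≥ : ∀ n N → recip (2+ n) ≤ log-approx (2+ n) N - log-approx (suc n) N
  log-increment≥ n N = subst (recip (2+ n) ≤_) (sym (log-increment n N)) (H-block-lower (suc N) (suc n))

  log-increment≤ : ∀ n N → log-approx (2+ n) N - log-approx (suc n) N ≤ recip (suc n)
  log-increment≤ n N = subst (_≤ recip (suc n)) (sym (log-increment n N)) (H-block-upper (suc N) (suc n))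

  γ-steps : ∀ N → Steps (λ n → H (suc n) - log-approx (suc n) N)
  γ-steps N n = subst (λ t → ∣ t ∣ ≤ gap n)
    (solve 4 (λ h r l l′ → r :- (l′ :- l) := ((h :+ r) :- l′) :- (h :- l)) refl
      (H (suc n)) r′ (log-approx (suc n) N) (log-approx (2+ n) N))
    (∣∣≤ (ℚ.≤-trans
           (subst (r′ - Δ ≤_) (ℚ.+-inverseʳ Δ) (ℚ.+-monoˡ-≤ (- Δ) (log-increment≥ n N)))
           (gap≥0 n))
         (subst (_≤ gap n) (solve 2 (λ d r → d :- r := :- (r :- d)) refl Δ r′)
           (ℚ.+-monoˡ-≤ (- r′) (log-increment≤ n N))))
    where
    r′ = recip (2+ n)
    Δ  = log-approx (2+ n) N - log-approx (suc n) N

  0≤q^n : ∀ {q} → 0ℚ ≤ q → ∀ n → 0ℚ ≤ q ^ n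
  0≤q^n 0≤q zero    = ℚ.<⇒≤ (recip>0 1)
  0≤q^n 0≤q (suc n) = 0≤* 0≤q (0≤q^n 0≤q n)

  q^n≤1 : ∀ {q} → 0ℚ ≤ q → q ≤ 1ℚ → ∀ n → q ^ n ≤ 1ℚ
  q^n≤1 {q} 0≤q q≤1 n = ℚ.≤-trans (p≤∣p∣ (q ^ n))
    (∣q^n∣≤1 (subst (_≤ 1ℚ) (sym (ℚ.0≤p⇒∣p∣≡p 0≤q)) q≤1) n)

  Li-first : ∀ s z → Li-approx s z 0 ≡ z
  Li-first s z = trans (ℚ.+-identityˡ _) (trans
    (cong₂ _*_ (ℚ.*-identityʳ z) (one^ {{ℕ.m^n≢0 1 s}} (ℕ.^-zeroˡ s))) (ℚ.*-identityʳ z))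
    where
    one^ : ∀ {k} .{{_ : ℕ.NonZero k}} → k ≡ 1 → recip k ≡ 1ℚ
    one^ refl = refl

  Li-lower : ∀ s {z} → 0ℚ ≤ z → ∀ N → z ≤ Li-approx s z N
  Li-lower s {z} 0≤z zero    = ℚ.≤-reflexive (sym (Li-first s z))
  Li-lower s {z} 0≤z (suc N) = ℚ.≤-trans (Li-lower s 0≤z N)
    (subst (_≤ Li-approx s z (suc N)) (ℚ.+-identityʳ (Li-approx s z N))
      (ℚ.+-monoʳ-≤ (Li-approx s z N) (0≤* (0≤q^n 0≤z (2+ N)) (recip^≥0 N s))))

  Li-upper : ∀ s {z} .{{_ : NonTrivial s}} → 0ℚ ≤ z → z ≤ 1ℚ → ∀ N →
             Li-approx s z N + (z * z) * recip (suc N) ≤ z + z * z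
  Li-upper s {z} 0≤z z≤1 zero    = ℚ.≤-reflexive (cong₂ _+_ (Li-first s z) (ℚ.*-identityʳ (z * z)))
  Li-upper s {z} 0≤z z≤1 (suc N) = begin
    (L + z ^ 2+ N * recip^ (2+ N) s) + (z * z) * r′
      ≤⟨ ℚ.+-monoˡ-≤ ((z * z) * r′) (ℚ.+-monoʳ-≤ L
           (*-mono-≤ (0≤q^n 0≤z (2+ N)) (gap≥0 N) z^≤z² (recip-^≤gap N s))) ⟩
    (L + (z * z) * (r - r′)) + (z * z) * r′
      ≡⟨ solve 4 (λ l w x y → (l :+ w :* (x :- y)) :+ w :* y := l :+ w :* x) refl L (z * z) r r′ ⟩
    L + (z * z) * r
      ≤⟨ Li-upper s 0≤z z≤1 N ⟩
    z + z * z ∎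
    where
    open ℚ.≤-Reasoning
    L  = Li-approx s z N
    r  = recip (suc N)
    r′ = recip (2+ N)
    z^≤z² : z ^ 2+ N ≤ z * z
    z^≤z² = subst (z ^ 2+ N ≤_) (cong (z *_) (ℚ.*-identityʳ z))
      (ℚ.*-monoˡ-≤-nonNeg z {{ℚ.nonNegative 0≤z}}
        (*-mono-≤ 0≤z (ℚ.<⇒≤ (recip>0 1)) ℚ.≤-refl (q^n≤1 0≤z z≤1 N)))

  C-steps : ∀ s .{{_ : NonTrivial s}} N →
            Steps (λ n → ∑ (λ k → Li-approx s (recip (suc k)) N) (suc n) - log-approx (suc n) N)
  C-steps s N n = subst (λ t → ∣ t ∣ ≤ gap n)
    (solve 4 (λ h r l l′ → r :- (l′ :- l) := ((h :+ r) :- l′) :- (h :- l)) refl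
      (∑ (λ k → Li-approx s (recip (suc k)) N) (suc n)) L (log-approx (suc n) N) (log-approx (2+ n) N))
    (∣∣≤
      (subst (L - Δ ≤_) (solve 2 (λ g r → (r :+ g) :- r := g) refl (gap n) r′)
        (ℚ.+-mono-≤ L≤ (ℚ.neg-antimono-≤ (log-increment≥ n N))))
      (subst (_≤ gap n) (solve 2 (λ d l → d :- l := :- (l :- d)) refl Δ L)
        (ℚ.+-mono-≤ (log-increment≤ n N) (ℚ.neg-antimono-≤ (Li-lower s 0≤r′ N)))))
    where
    r′ = recip (2+ n)
    0≤r′ = recip≥0 (2+ n)
    L  = Li-approx s r′ N
    Δ  = log-approx (2+ n) N - log-approx (suc n) N
    r′r′≤gap : r′ * r′ ≤ gap n
    r′r′≤gap = subst (r′ * r′ ≤_) (sym (gap≡* n))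
      (ℚ.*-monoʳ-≤-nonNeg r′ {{ℚ.nonNegative 0≤r′}} (recip-antitone {suc n} {2+ n} (ℕ.n≤1+n (suc n))))
    L≤ : L ≤ r′ + gap n
    L≤ = begin
      L                               ≡⟨ sym (ℚ.+-identityʳ L) ⟩
      L + 0ℚ                          ≤⟨ ℚ.+-monoʳ-≤ L (0≤* (0≤* 0≤r′ 0≤r′) (recip≥0 (suc N))) ⟩
      L + (r′ * r′) * recip (suc N)   ≤⟨ Li-upper s 0≤r′ (recip-antitone {1} {2+ n} (s≤s z≤n)) N ⟩
      r′ + r′ * r′                    ≤⟨ ℚ.+-monoʳ-≤ r′ r′r′≤gap ⟩
      r′ + gap n                      ∎
      where open ℚ.≤-Reasoning

-- A real number is a Cauchy sequence of rationals; the modulus is the first component of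
-- the Σ-type in IsCauchy.  Sequences with the same limit are different elements of ℝ, and
-- real numbers are compared only through _<_ and _⟶_.

open RationalSequences
  using (IsCauchy; recip; gap; ∣recip∣≤1; γ-steps; C-steps; ζ-approx; Li-approx; log-approx; cauchy-const; cauchy-+; cauchy-neg;
         cauchy-abs; cauchy-/; steps⇒cauchy; ζ-steps; Li-steps; log-steps)

record ℝ : Set where
  constructor mkℝ
  field
    seq    : ℕ → ℚ
    cauchy : IsCauchy seq

open ℝ public

infixl 6 _+_ _-_
infixl 7 _/_
infix  8 -_
infix  4 _<_ _⟶_

fromℚ : ℚ → ℝ
fromℚ q = mkℝ (λ _ → q) (cauchy-const q)

0ℝ 1ℝ : ℝ
0ℝ = fromℚ 0ℚ
1ℝ = fromℚ 1ℚ

_+_ : ℝ → ℝ → ℝ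
x + y = mkℝ (λ n → seq x n ℚ.+ seq y n) (cauchy-+ (seq x) (seq y) (cauchy x) (cauchy y))

-_ : ℝ → ℝ
- x = mkℝ (λ n → ℚ.- seq x n) (cauchy-neg (seq x) (cauchy x))

_-_ : ℝ → ℝ → ℝ
x - y = x + (- y)

∣_∣ : ℝ → ℝ
∣ x ∣ = mkℝ (λ n → ℚ.∣ seq x n ∣) (cauchy-abs (seq x) (cauchy x))

_/_ : ℝ → (d : ℕ) .{{_ : ℕ.NonZero d}} → ℝ
x / d = mkℝ (λ n → seq x n ℚ.* recip d) (cauchy-/ (seq x) (cauchy x) d)

_<_ : ℝ → ℝ → Set
x < y = ∃ λ δ → 0ℚ ℚ.< δ × ∃ λ N → ∀ n → N ℕ.≤ n → seq x n ℚ.+ δ ℚ.≤ seq y n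

∑ : (ℕ → ℝ) → ℕ → ℝ
∑ f zero    = 0ℝ
∑ f (suc n) = ∑ f n + f n

_⟶_ : (ℕ → ℝ) → ℝ → Set
x ⟶ l = ∀ ε → 0ℚ ℚ.< ε → ∃ λ N → ∀ n → N ℕ.≤ n → ∣ x n - l ∣ < fromℚ ε

IsCauchyℝ : (ℕ → ℝ) → Set
IsCauchyℝ x = ∀ ε → 0ℚ ℚ.< ε → ∃ λ N → ∀ m n → N ℕ.≤ m → N ℕ.≤ n → ∣ x m - x n ∣ < fromℚ ε

module Completeness where

  open RationalSequences
  open import Data.Rational.Solver using (module +-*-Solver)
  open +-*-Solver using (solve; _:=_; _:+_; _:-_)

  eventually≤⇒< : ∀ x {q ε} N → (∀ n → N ℕ.≤ n → seq x n ℚ.≤ q) → q ℚ.< ε → x < fromℚ ε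
  eventually≤⇒< x {q} {ε} N h q<ε = ε ℚ.- q , p<q⇒0<q-p q<ε , N , λ n N≤n →
    subst (seq x n ℚ.+ (ε ℚ.- q) ℚ.≤_) (solve 2 (λ q e → q :+ (e :- q) := e) refl q ε)
      (ℚ.+-monoˡ-≤ (ε ℚ.- q) (h n N≤n))

  <⇒eventually≤ : ∀ x {ε} → x < fromℚ ε → ∃ λ N → ∀ n → N ℕ.≤ n → seq x n ℚ.≤ ε
  <⇒eventually≤ x {ε} (δ , 0<δ , N , h) = N , λ n N≤n → ℚ.≤-trans
    (subst (ℚ._≤ seq x n ℚ.+ δ) (ℚ.+-identityʳ (seq x n)) (ℚ.+-monoʳ-≤ (seq x n) (ℚ.<⇒≤ 0<δ)))
    (h n N≤n)

  steps⇒cauchyℝ : ∀ x → (∀ N → Steps (λ n → seq (x n) N)) → IsCauchyℝ x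
  steps⇒cauchyℝ x st ε 0<ε = K , λ m n K≤m K≤n → eventually≤⇒< ∣ x m - x n ∣ 0
    (λ N _ → steps-bound (λ i → seq (x i) N) (st N) m n K≤m K≤n) (proj₂ (archimedean ε 0<ε))
    where K = proj₁ (archimedean ε 0<ε)

  double : ℚ → ℚ
  double q = q ℚ.+ q

  double-½ : ∀ {q ε} → q ℚ.< ½ ℚ.* ε → double q ℚ.< ε
  double-½ {q} {ε} h = subst (double q ℚ.<_) (½+½ ε) (ℚ.+-mono-< h h)

  double-mono : ∀ {p q} → p ℚ.≤ q → double p ℚ.≤ double q
  double-mono h = ℚ.+-mono-≤ h h

  ≤double : ∀ {q} → 0ℚ ℚ.≤ q → q ℚ.≤ double q
  ≤double {q} 0≤q = subst (ℚ._≤ double q) (ℚ.+-identityʳ q) (ℚ.+-monoʳ-≤ q 0≤q)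

  ∣-∣-triangle₃ : ∀ p q r s {e} → ℚ.∣ p ℚ.- q ∣ ℚ.≤ e → ℚ.∣ q ℚ.- r ∣ ℚ.≤ e →
                  ℚ.∣ r ℚ.- s ∣ ℚ.≤ double e → ℚ.∣ p ℚ.- s ∣ ℚ.≤ double (double e)
  ∣-∣-triangle₃ p q r s h₁ h₂ h₃ = ℚ.≤-trans (∣-∣-triangle p r s)
    (ℚ.+-mono-≤ (ℚ.≤-trans (∣-∣-triangle p q r) (ℚ.+-mono-≤ h₁ h₂)) h₃)

  -- The limit of x is represented by a diagonal sequence: its j-th entry approximates
  -- the member of x at stage j, which is within 1/(j+1) of every later member.
  module Limit (x : ℕ → ℝ) (c : IsCauchyℝ x) where

    u : ℕ → ℚ
    u j = recip (suc j)

    u>0 : ∀ j → 0ℚ ℚ.< u j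
    u>0 j = recip>0 (suc j)

    u≥0 : ∀ j → 0ℚ ℚ.≤ u j
    u≥0 j = recip≥0 (suc j)

    u-antitone : ∀ {i j} → i ℕ.≤ j → u j ℚ.≤ u i
    u-antitone {i} {j} i≤j = recip-antitone {suc i} {suc j} (s≤s i≤j)

    stage : ℕ → ℕ
    stage j = proj₁ (c (u j) (u>0 j))

    term : ℕ → ℝ
    term j = x (stage j)

    depth : ℕ → ℕ
    depth j = proj₁ (cauchy (term j) (u j) (u>0 j))

    diagonal : ℕ → ℚ
    diagonal j = seq (term j) (depth j)

    near : ∀ {J} j → J ℕ.≤ j → ∀ a → depth j ℕ.≤ a → ℚ.∣ seq (term j) a ℚ.- diagonal j ∣ ℚ.≤ u J
    near j J≤j a d≤a = ℚ.≤-trans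
      (ℚ.<⇒≤ (proj₂ (cauchy (term j) (u j) (u>0 j)) a (depth j) d≤a ℕ.≤-refl)) (u-antitone J≤j)

    terms : ∀ {J} i j → J ℕ.≤ i → J ℕ.≤ j →
            ∃ λ K → ∀ a → K ℕ.≤ a → ℚ.∣ seq (term i) a ℚ.- seq (term j) a ∣ ℚ.≤ u J
    terms {J} i j J≤i J≤j = choose (ℕ.≤-total (stage i) (stage j))
      where
      Δ = ∣ term i - term j ∣
      weaken : ∀ k → J ℕ.≤ k → Δ < fromℚ (u k) → ∃ λ K → ∀ a → K ℕ.≤ a → seq Δ a ℚ.≤ u J
      weaken k J≤k h = proj₁ bound , λ a K≤a → ℚ.≤-trans (proj₂ bound a K≤a) (u-antitone J≤k)
        where bound = <⇒eventually≤ Δ h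
      choose : stage i ℕ.≤ stage j ⊎ stage j ℕ.≤ stage i →
               ∃ λ K → ∀ a → K ℕ.≤ a → seq Δ a ℚ.≤ u J
      choose (inj₁ i≤j) = weaken i J≤i (proj₂ (c (u i) (u>0 i)) (stage i) (stage j) ℕ.≤-refl i≤j)
      choose (inj₂ j≤i) = weaken j J≤j (proj₂ (c (u j) (u>0 j)) (stage i) (stage j) j≤i ℕ.≤-refl)

    diagonal-bound : ∀ J i j → J ℕ.≤ i → J ℕ.≤ j →
                     ℚ.∣ diagonal i ℚ.- diagonal j ∣ ℚ.≤ double (double (u J))
    diagonal-bound J i j J≤i J≤j = ∣-∣-triangle₃ (diagonal i) (seq (term i) a) (seq (term j) a) (diagonal j)
      (subst (ℚ._≤ u J) (∣-∣-sym (seq (term i) a) (diagonal i)) (near i J≤i a di≤a))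
      (proj₂ (terms i j J≤i J≤j) a (ℕ.m≤m⊔n K (depth i ℕ.⊔ depth j)))
      (ℚ.≤-trans (near j J≤j a dj≤a) (≤double (u≥0 J)))
      where
      K = proj₁ (terms i j J≤i J≤j)
      a = K ℕ.⊔ (depth i ℕ.⊔ depth j)
      di≤a = ℕ.≤-trans (ℕ.m≤m⊔n (depth i) (depth j)) (ℕ.m≤n⊔m K (depth i ℕ.⊔ depth j))
      dj≤a = ℕ.≤-trans (ℕ.m≤n⊔m (depth i) (depth j)) (ℕ.m≤n⊔m K (depth i ℕ.⊔ depth j))

    small : ∀ ε → 0ℚ ℚ.< ε → ∃ λ J → double (double (double (u J))) ℚ.< ε
    small ε 0<ε = proj₁ J , double-½ (double-½ (double-½ (proj₂ J)))
      where J = archimedean (½ ℚ.* (½ ℚ.* (½ ℚ.* ε))) (½-pos (½-pos (½-pos 0<ε)))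

    4u≤8u : ∀ J → double (double (u J)) ℚ.≤ double (double (double (u J)))
    4u≤8u J = ≤double (0≤+ (0≤+ (u≥0 J) (u≥0 J)) (0≤+ (u≥0 J) (u≥0 J)))

    diagonal-cauchy : IsCauchy diagonal
    diagonal-cauchy ε 0<ε = J , λ i j J≤i J≤j →
      ℚ.≤-<-trans (ℚ.≤-trans (diagonal-bound J i j J≤i J≤j) (4u≤8u J)) (proj₂ (small ε 0<ε))
      where J = proj₁ (small ε 0<ε)

    limit : ℝ
    limit = mkℝ diagonal diagonal-cauchy

    converges : x ⟶ limit
    converges ε 0<ε = stage J , close
      where
      J = proj₁ (small ε 0<ε)
      close : ∀ n → stage J ℕ.≤ n → ∣ x n - limit ∣ < fromℚ ε
      close n sJ≤n = eventually≤⇒< ∣ x n - limit ∣ (K ℕ.⊔ (depth J ℕ.⊔ J)) (λ a N≤a →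
        let dJ⊔J≤a = ℕ.m⊔n≤o⇒n≤o K (depth J ℕ.⊔ J) N≤a in
        ∣-∣-triangle₃ (seq (x n) a) (seq (term J) a) (diagonal J) (diagonal a)
          (ℚ.≤-trans (proj₂ bound a (ℕ.m⊔n≤o⇒m≤o K (depth J ℕ.⊔ J) N≤a)) (≤double (u≥0 J)))
          (ℚ.≤-trans (near J ℕ.≤-refl a (ℕ.m⊔n≤o⇒m≤o (depth J) J dJ⊔J≤a)) (≤double (u≥0 J)))
          (diagonal-bound J J a ℕ.≤-refl (ℕ.m⊔n≤o⇒n≤o (depth J) J dJ⊔J≤a)))
        (proj₂ (small ε 0<ε))
        where
        bound = <⇒eventually≤ ∣ x n - term J ∣ (proj₂ (c (u J) (u>0 J)) n (stage J) sJ≤n ℕ.≤-refl)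
        K = proj₁ bound

opaque
  lim : (x : ℕ → ℝ) → IsCauchyℝ x → ℝ
  lim x c = Completeness.Limit.limit x c

  lim-converges : ∀ x c → x ⟶ lim x c
  lim-converges x c = Completeness.Limit.converges x c

-- ζ, Li and log are the limits of the rational sequences ζ-approx, Li-approx, log-approx.

ζ : (s : ℕ) .{{_ : NonTrivial s}} → ℝ
ζ s = mkℝ (ζ-approx s) (steps⇒cauchy (ζ-approx s) (ζ-steps s))

Li : (s : ℕ) .{{_ : NonTrivial s}} (z : ℚ) → ℚ.∣ z ∣ ℚ.≤ 1ℚ → ℝ
Li s z ∣z∣≤1 = mkℝ (Li-approx s z) (steps⇒cauchy (Li-approx s z) (Li-steps s z ∣z∣≤1))

log : (n : ℕ) .{{_ : ℕ.NonZero n}} → ℝ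
log n = mkℝ (log-approx n) (steps⇒cauchy (log-approx n) (log-steps n))

-- Both defining sequences are indexed from 0, so their i-th entry is the term n = i + 1.

γ-seq : ℕ → ℝ
γ-seq i = ∑ (λ k → fromℚ (recip (suc k))) (suc i) - log (suc i)

C-seq : (m : ℕ) .{{_ : NonTrivial m}} → ℕ → ℝ
C-seq m i = ∑ (λ k → Li m (recip (suc k)) (∣recip∣≤1 (suc k))) (suc i) - log (suc i)

seq-∑ : ∀ f n N → seq (∑ f n) N ≡ RationalSequences.∑ (λ k → seq (f k) N) n
seq-∑ f zero    N = refl
seq-∑ f (suc n) N = cong (ℚ._+ seq (f n) N) (seq-∑ f n N)

γ-cauchy : IsCauchyℝ γ-seq
γ-cauchy = Completeness.steps⇒cauchyℝ γ-seq λ N n → subst₂ (λ s t →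
    ℚ.∣ (s ℚ.- log-approx (2+ n) N) ℚ.- (t ℚ.- log-approx (suc n) N) ∣ ℚ.≤ gap n)
  (sym (seq-∑ (λ k → fromℚ (recip (suc k))) (2+ n) N))
  (sym (seq-∑ (λ k → fromℚ (recip (suc k))) (suc n) N))
  (γ-steps N n)

C-cauchy : ∀ m .{{_ : NonTrivial m}} → IsCauchyℝ (C-seq m)
C-cauchy m = Completeness.steps⇒cauchyℝ (C-seq m) λ N n → subst₂ (λ s t →
    ℚ.∣ (s ℚ.- log-approx (2+ n) N) ℚ.- (t ℚ.- log-approx (suc n) N) ∣ ℚ.≤ gap n)
  (sym (seq-∑ (λ k → Li m (recip (suc k)) (∣recip∣≤1 (suc k))) (2+ n) N))
  (sym (seq-∑ (λ k → Li m (recip (suc k)) (∣recip∣≤1 (suc k))) (suc n) N))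
  (C-steps m N n)

γ : ℝ
γ = lim γ-seq γ-cauchy

C : (m : ℕ) .{{_ : NonTrivial m}} → ℝ
C m = lim (C-seq m) (C-cauchy m)

{-# OPTIONS --safe #-}

-- With a(k,j) = k^-j j^-m, the logarithms in the defining sequences of C_m and γ cancel, and
-- 1 - γ - ζ(m) + C_m is the limit of Σ_{2≤k≤K} Σ_{j≥2} a(k,j) (the terms k = 1 of the sums of
-- Li_m(1/k) - 1/k give ζ(m) - 1), while the series in the theorem is Σ_{j≥2} Σ_{k≥2} a(k,j).
-- The two orders of summation agree because a(k,j) is dominated by the product of
-- 1/(k(k-1)) and 1/(j(j-1)), so that rectangular sums have uniformly small tails.

module Submission where

import Defs
open import Data.Nat.Base as ℕ using (ℕ; zero; suc; 2+; _^_; NonTrivial)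
open import Data.Nat.Properties as ℕ using (m^n≢0)
open import Data.Product.Base using (_,_; proj₁; proj₂)
open import Data.Rational.Base as ℚ using (ℚ; 0ℚ; 1ℚ; ½)
import Data.Rational.Properties as ℚ
open import Function.Base using (flip)
open import Relation.Binary.PropositionalEquality
  using (_≡_; refl; sym; trans; cong; cong₂; subst; module ≡-Reasoning)

module RationalSums where

  open Defs.RationalSequences renaming (_^_ to _^ℚ_)
  open import Data.Rational.Base using (_+_; _*_; _-_; -_; _≤_; _<_; ∣_∣)
  open import Data.Rational.Solver using (module +-*-Solver)
  open +-*-Solver using (solve; _:=_; _:+_; _:*_; _:-_; :-_)

  ∑-head : ∀ f n → ∑ f (suc n) ≡ f 0 + ∑ (λ j → f (suc j)) n
  ∑-head f zero    = ℚ.+-comm 0ℚ (f 0)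
  ∑-head f (suc n) = trans (cong (_+ f (suc n)) (∑-head f n)) (ℚ.+-assoc (f 0) _ (f (suc n)))

  ∑-+ : ∀ f g n → ∑ f n + ∑ g n ≡ ∑ (λ j → f j + g j) n
  ∑-+ f g zero    = refl
  ∑-+ f g (suc n) = trans
    (solve 4 (λ a b c d → (a :+ b) :+ (c :+ d) := (a :+ c) :+ (b :+ d)) refl
      (∑ f n) (f n) (∑ g n) (g n))
    (cong (_+ (f n + g n)) (∑-+ f g n))

  ∑-- : ∀ f g n → ∑ f n - ∑ g n ≡ ∑ (λ j → f j - g j) n
  ∑-- f g zero    = refl
  ∑-- f g (suc n) = trans
    (solve 4 (λ a b c d → (a :+ b) :- (c :+ d) := (a :- c) :+ (b :- d)) refl
      (∑ f n) (f n) (∑ g n) (g n))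
    (cong (_+ (f n - g n)) (∑-- f g n))

  ∑-*ʳ : ∀ f c n → ∑ f n * c ≡ ∑ (λ j → f j * c) n
  ∑-*ʳ f c zero    = ℚ.*-zeroˡ c
  ∑-*ʳ f c (suc n) = trans (ℚ.*-distribʳ-+ c (∑ f n) (f n)) (cong (_+ f n * c) (∑-*ʳ f c n))

  ∑-zero : ∀ n → ∑ (λ _ → 0ℚ) n ≡ 0ℚ
  ∑-zero zero    = refl
  ∑-zero (suc n) = trans (ℚ.+-identityʳ _) (∑-zero n)

  ∑-swap : ∀ (f : ℕ → ℕ → ℚ) m n → ∑ (λ p → ∑ (f p) n) m ≡ ∑ (λ q → ∑ (λ p → f p q) m) n
  ∑-swap f zero    n = sym (∑-zero n)
  ∑-swap f (suc m) n = trans (cong (_+ ∑ (f m) n) (∑-swap f m n))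
    (∑-+ (λ q → ∑ (λ p → f p q) m) (f m) n)

  ∑-mono : ∀ {f g} → (∀ j → f j ≤ g j) → ∀ n → ∑ f n ≤ ∑ g n
  ∑-mono h zero    = ℚ.≤-refl
  ∑-mono h (suc n) = ℚ.+-mono-≤ (∑-mono h n) (h n)

  ∑-nonneg : ∀ {f} → (∀ j → 0ℚ ≤ f j) → ∀ n → 0ℚ ≤ ∑ f n
  ∑-nonneg h zero    = ℚ.≤-refl
  ∑-nonneg h (suc n) = 0≤+ (∑-nonneg h n) (h n)

  ∑-gap : ∀ n → ∑ gap n ≡ 1ℚ - recip (suc n)
  ∑-gap zero    = refl
  ∑-gap (suc n) = trans (cong (_+ gap n) (∑-gap n))
    (solve 3 (λ o r s → (o :- r) :+ (r :- s) := o :- s) refl 1ℚ (recip (suc n)) (recip (2+ n)))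

  ∑-gap≤1 : ∀ n → ∑ gap n ≤ 1ℚ
  ∑-gap≤1 n = subst (_≤ 1ℚ) (sym (∑-gap n))
    (subst (1ℚ - recip (suc n) ≤_) (ℚ.+-identityʳ 1ℚ)
      (ℚ.+-monoʳ-≤ 1ℚ (ℚ.neg-antimono-≤ (recip≥0 (suc n)))))

  -- Since `gap p` equals 1/((p+1)(p+2)), the dominating function is 1/(k(k-1)) times 1/(j(j-1))
  -- with k = p+2 and j = q+2.
  GapDominated : (ℕ → ℕ → ℚ) → Set
  GapDominated f = ∀ p q → f p q ≤ gap p * gap q

  -- Row `m` contributes at most `gap m` times a partial sum of `gap`, and those partial sums
  -- telescope to at most 1. The bound does not involve `n`, so the tails in `m` are small uniformly
  -- in the width of the rectangle.
  rectangle-steps : ∀ f → (∀ p q → 0ℚ ≤ f p q) → GapDominated f →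
                    ∀ n → Steps (λ m → ∑ (λ p → ∑ (f p) n) m)
  rectangle-steps f 0≤f f≤gap n m = begin
    ∣ ∑ (λ p → ∑ (f p) n) (suc m) - ∑ (λ p → ∑ (f p) n) m ∣ ≡⟨ ∣∑-step∣ (λ p → ∑ (f p) n) m ⟩
    ∣ ∑ (f m) n ∣                  ≡⟨ ℚ.0≤p⇒∣p∣≡p (∑-nonneg (0≤f m) n) ⟩
    ∑ (f m) n                      ≤⟨ ∑-mono (f≤gap m) n ⟩
    ∑ (λ q → gap m * gap q) n      ≡⟨ ∑-cong (λ q → ℚ.*-comm (gap m) (gap q)) n ⟩
    ∑ (λ q → gap q * gap m) n      ≡⟨ sym (∑-*ʳ gap (gap m) n) ⟩
    ∑ gap n * gap m                ≤⟨ ℚ.*-monoʳ-≤-nonNeg (gap m) {{ℚ.nonNegative (gap≥0 m)}} (∑-gap≤1 n) ⟩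
    1ℚ * gap m                     ≡⟨ ℚ.*-identityˡ (gap m) ⟩
    gap m                          ∎
    where open ℚ.≤-Reasoning

  -- Both sides are compared with the N × N square.
  iterated-sums-close : ∀ f → (∀ p q → 0ℚ ≤ f p q) → GapDominated f →
    ∀ K {m n N} → K ℕ.≤ m → K ℕ.≤ n → K ℕ.≤ N →
    ∣ ∑ (λ q → ∑ (λ p → f p q) N) n - ∑ (λ p → ∑ (f p) N) m ∣ ≤ recip (suc K) + recip (suc K)
  iterated-sums-close f 0≤f f≤gap K {m} {n} {N} K≤m K≤n K≤N = ℚ.≤-trans
    (∣-∣-triangle (cols n) (cols N) (rows m))
    (ℚ.+-mono-≤
      (steps-bound cols (rectangle-steps (flip f) (flip 0≤f) flip-dominated N) n N K≤n K≤N)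
      (subst (λ s → ∣ s - rows m ∣ ≤ recip (suc K)) (∑-swap f N N)
        (steps-bound rows (rectangle-steps f 0≤f f≤gap N) N m K≤N K≤m)))
    where
    rows cols : ℕ → ℚ
    rows = ∑ (λ p → ∑ (f p) N)
    cols = ∑ (λ q → ∑ (λ p → f p q) N)
    flip-dominated : GapDominated (flip f)
    flip-dominated q p = subst (f p q ≤_) (ℚ.*-comm (gap p) (gap q)) (f≤gap p q)

  -- `ζ-approx` takes reciprocals of natural powers, whereas `Li-approx` takes rational powers of
  -- its argument 1/k; this reconciles the two.
  recip-^ : ∀ n s .{{_ : ℕ.NonZero n}} → recip^ n s ≡ recip n ^ℚ s
  recip-^ n zero    = refl
  recip-^ n (suc s) = trans (recip-* n (n ^ s)) (cong (recip n *_) (recip-^ n s))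
    where instance _ = m^n≢0 n s

  1^ : ∀ n → 1ℚ ^ℚ n ≡ 1ℚ
  1^ zero    = refl
  1^ (suc n) = trans (ℚ.*-identityˡ (1ℚ ^ℚ n)) (1^ n)

  recip^-1 : ∀ s → recip^ 1 s ≡ 1ℚ
  recip^-1 s = trans (recip-^ 1 s) (1^ s)

  module _ (m : ℕ) where

    -- This is a(k,j) with k = p+2 and j = q+2, so that both indices start from 0.
    term : ℕ → ℕ → ℚ
    term p q = recip^ (2+ p) (2+ q) * recip^ (2+ q) m

    term≥0 : ∀ p q → 0ℚ ≤ term p q
    term≥0 p q = 0≤* (recip^≥0 p (2+ q)) (recip^≥0 q m)

    -- `ζ-approx` at `N` has N+1 terms; subtracting 1 removes the one for k = 1 and leaves the `N`
    -- entries of column `q`.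
    ζ-tail : ∀ q N → (ζ-approx (2+ q) N - 1ℚ) * recip^ (2+ q) m ≡ ∑ (λ p → term p q) N
    ζ-tail q N = trans (cong (_* recip^ (2+ q) m) tail) (∑-*ʳ (λ p → recip^ (2+ p) (2+ q)) _ N)
      where
      tail : ζ-approx (2+ q) N - 1ℚ ≡ ∑ (λ p → recip^ (2+ p) (2+ q)) N
      tail = trans (cong₂ _-_ (∑-head (λ j → recip^ (suc j) (2+ q)) N) (sym (recip^-1 (2+ q))))
        (solve 2 (λ a b → (a :+ b) :- a := b) refl (recip^ 1 (2+ q)) _)

    -- The j = 1 term of Li_m(z) is z itself; what remains is row `p`, also cut off after `N`
    -- entries.
    Li-tail : ∀ p N → Li-approx m (recip (2+ p)) N - recip (2+ p) ≡ ∑ (term p) N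
    Li-tail p N = begin
      Li-approx m z N - z
        ≡⟨ cong₂ _-_ (∑-head f N) (sym (trans (sym (ℚ.+-identityˡ (f 0))) (Li-first m z))) ⟩
      (f 0 + ∑ (λ j → f (suc j)) N) - f 0
        ≡⟨ solve 2 (λ a b → (a :+ b) :- a := b) refl (f 0) _ ⟩
      ∑ (λ j → f (suc j)) N
        ≡⟨ ∑-cong (λ q → cong (_* recip^ (2+ q) m) (sym (recip-^ (2+ p) (2+ q)))) N ⟩
      ∑ (term p) N ∎
      where
      open ≡-Reasoning
      z = recip (2+ p)
      f : ℕ → ℚ
      f j = z ^ℚ suc j * recip^ (suc j) m

    Li-1 : ∀ N → Li-approx m 1ℚ N ≡ ζ-approx m N
    Li-1 N = ∑-cong (λ j → trans (cong (_* recip^ (suc j) m) (1^ (suc j)))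
      (ℚ.*-identityˡ (recip^ (suc j) m))) (suc N)

    -- The k = 1 term of the difference is Li_m(1) - 1, truncated, which cancels the leading
    -- parenthesis. The `i` terms from k = 2 on are row sums by `Li-tail`.
    Li-H-excess : ∀ i N →
      (1ℚ - ζ-approx m N) + (∑ (λ k → Li-approx m (recip (suc k)) N) (suc i) - H (suc i))
        ≡ ∑ (λ p → ∑ (term p) N) i
    Li-H-excess i N = begin
      (1ℚ - ζ-approx m N) + (∑ L (suc i) - H (suc i))
        ≡⟨ cong ((1ℚ - ζ-approx m N) +_) (trans (∑-- L r (suc i)) (∑-head (λ k → L k - r k) i)) ⟩
      (1ℚ - ζ-approx m N) + ((L 0 - 1ℚ) + ∑ (λ p → L (suc p) - r (suc p)) i)
        ≡⟨ cong₂ (λ x y → (1ℚ - ζ-approx m N) + ((x - 1ℚ) + y)) (Li-1 N) (∑-cong (λ p → Li-tail p N) i) ⟩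
      (1ℚ - ζ-approx m N) + ((ζ-approx m N - 1ℚ) + ∑ (λ p → ∑ (term p) N) i)
        ≡⟨ solve 3 (λ o z s → (o :- z) :+ ((z :- o) :+ s) := s) refl 1ℚ (ζ-approx m N) _ ⟩
      ∑ (λ p → ∑ (term p) N) i ∎
      where
      open ≡-Reasoning
      L r : ℕ → ℚ
      L k = Li-approx m (recip (suc k)) N
      r k = recip (suc k)

    module _ .{{_ : NonTrivial m}} where

      -- Both exponents, j = q+2 and `m`, are at least 2, so `recip-^≤gap` bounds each factor
      -- separately.
      term≤gap : GapDominated term
      term≤gap p q = *-mono-≤ (recip^≥0 p (2+ q)) (gap≥0 q) (recip-^≤gap p (2+ q)) (recip-^≤gap q m)

      -- Here g, c approximate γ and C_m, and l is the logarithm common to their defining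
      -- sequences.
      partial-sum-close : ∀ K {i n N} → K ℕ.≤ i → K ℕ.≤ n → K ℕ.≤ N → ∀ l g c {e} →
        ∣ (H (suc i) - l) - g ∣ ≤ e →
        ∣ (∑ (λ k → Li-approx m (recip (suc k)) N) (suc i) - l) - c ∣ ≤ e →
        ∣ ∑ (λ q → (ζ-approx (2+ q) N - 1ℚ) * recip^ (2+ q) m) n - (((1ℚ - g) - ζ-approx m N) + c) ∣
          ≤ (recip (suc K) + recip (suc K)) + (e + e)
      partial-sum-close K {i} {n} {N} K≤i K≤n K≤N l g c {e} hγ hC = begin
        ∣ S - R ∣                                    ≤⟨ ∣-∣-triangle S D R ⟩
        ∣ S - D ∣ + ∣ D - R ∣
          ≡⟨ cong₂ (λ x y → ∣ x ∣ + ∣ y ∣)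
               (cong₂ _-_ (∑-cong (λ q → ζ-tail q N) n) (Li-H-excess i N))
               -- The logarithm `l` occurs in both `dC` and `dγ` and cancels in their difference,
               -- which is exactly `D - R`.
               (solve 7 (λ o z λi h l g c → ((o :- z) :+ (λi :- h)) :- (((o :- g) :- z) :+ c)
                  := ((λi :- l) :- c) :+ (:- ((h :- l) :- g))) refl
                  1ℚ (ζ-approx m N) Λ (H (suc i)) l g c) ⟩
        ∣ ∑ (λ q → ∑ (λ p → term p q) N) n - ∑ (λ p → ∑ (term p) N) i ∣ + ∣ dC + - dγ ∣
          ≤⟨ ℚ.+-mono-≤ (iterated-sums-close term term≥0 term≤gap K K≤i K≤n K≤N)
               (ℚ.≤-trans (ℚ.∣p+q∣≤∣p∣+∣q∣ dC (- dγ))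
                 (ℚ.+-mono-≤ hC (subst (_≤ e) (sym (ℚ.∣-p∣≡∣p∣ dγ)) hγ))) ⟩
        (recip (suc K) + recip (suc K)) + (e + e)   ∎
        where
        open ℚ.≤-Reasoning
        Λ  = ∑ (λ k → Li-approx m (recip (suc k)) N) (suc i)
        S  = ∑ (λ q → (ζ-approx (2+ q) N - 1ℚ) * recip^ (2+ q) m) n
        R  = ((1ℚ - g) - ζ-approx m N) + c
        D  = (1ℚ - ζ-approx m N) + (Λ - H (suc i))
        dγ = (H (suc i) - l) - g
        dC = (Λ - l) - c

  -- The error budget has four shares: two tails `r` below ε/4, and the errors for γ and C_m, each
  -- at most ε/4. Strictness comes from the tails.
  quarters : ∀ {r ε} → r < ½ * (½ * ε) → (r + r) + (½ * (½ * ε) + ½ * (½ * ε)) < ε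
  quarters {r} {ε} h = subst ((r + r) + (½ * (½ * ε) + ½ * (½ * ε)) <_)
    (trans (cong₂ _+_ (½+½ (½ * ε)) (½+½ (½ * ε))) (½+½ ε))
    (ℚ.+-monoˡ-< (½ * (½ * ε) + ½ * (½ * ε)) (ℚ.+-mono-< h h))

open import Defs
open RationalSequences using (archimedean; recip; ½-pos; ∣recip∣≤1; log-approx)
open RationalSums using (partial-sum-close; quarters)

module _ (m : ℕ) .{{_ : NonTrivial m}} where

  summand : ℕ → ℝ
  summand i = ((ζ (2+ i) - 1ℝ) / (2+ i ^ m)) {{m^n≢0 (2+ i) m}}

  value : ℝ
  value = 1ℝ - γ - ζ m + C m

  -- The rational estimate holds at every late enough precision `N`. As its bound lies below `ε` by
  -- a fixed margin, the strict inequality of reals follows.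
  partial-sum-near : ∀ {e ε} → 0ℚ ℚ.< e → ∀ K →
    (recip (suc K) ℚ.+ recip (suc K)) ℚ.+ (e ℚ.+ e) ℚ.< ε →
    ∀ n → K ℕ.≤ n → ∣ ∑ summand n - value ∣ < fromℚ ε
  partial-sum-near {e} 0<e K small n K≤n =
    Completeness.eventually≤⇒< ∣ ∑ summand n - value ∣ (K ℕ.⊔ (Nγ ℕ.⊔ NC)) bound small
    where
    γ⟶ = lim-converges γ-seq γ-cauchy e 0<e
    C⟶ = lim-converges (C-seq m) (C-cauchy m) e 0<e
    Iγ = proj₁ γ⟶
    IC = proj₁ C⟶
    -- At least `K` for the tail estimate, and late enough in both defining sequences to be within
    -- `e` of γ and C_m.
    i  = K ℕ.⊔ (Iγ ℕ.⊔ IC)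
    γ-close = Completeness.<⇒eventually≤ ∣ γ-seq i - γ ∣ (proj₂ γ⟶ i
      (ℕ.≤-trans (ℕ.m≤m⊔n Iγ IC) (ℕ.m≤n⊔m K (Iγ ℕ.⊔ IC))))
    C-close = Completeness.<⇒eventually≤ ∣ C-seq m i - C m ∣ (proj₂ C⟶ i
      (ℕ.≤-trans (ℕ.m≤n⊔m Iγ IC) (ℕ.m≤n⊔m K (Iγ ℕ.⊔ IC))))
    Nγ = proj₁ γ-close
    NC = proj₁ C-close
    bound : ∀ N → K ℕ.⊔ (Nγ ℕ.⊔ NC) ℕ.≤ N →
            seq ∣ ∑ summand n - value ∣ N ℚ.≤ (recip (suc K) ℚ.+ recip (suc K)) ℚ.+ (e ℚ.+ e)
    -- `seq-∑` turns finite sums of reals into rational sums at precision `N`. The limits γ and C_m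
    -- are opaque and enter only through `γ-close` and `C-close`.
    bound N N≥ = subst (λ s → ℚ.∣ s ℚ.- seq value N ∣ ℚ.≤ _) (sym (seq-∑ summand n N))
      (partial-sum-close m K (ℕ.m≤m⊔n K (Iγ ℕ.⊔ IC)) K≤n (ℕ.m⊔n≤o⇒m≤o K (Nγ ℕ.⊔ NC) N≥)
        (log-approx (suc i) N) (seq γ N) (seq (C m) N)
        (subst (λ s → ℚ.∣ (s ℚ.- log-approx (suc i) N) ℚ.- seq γ N ∣ ℚ.≤ e)
          (seq-∑ (λ k → fromℚ (recip (suc k))) (suc i) N)
          (proj₂ γ-close N (ℕ.m⊔n≤o⇒m≤o Nγ NC N≥′)))
        (subst (λ s → ℚ.∣ (s ℚ.- log-approx (suc i) N) ℚ.- seq (C m) N ∣ ℚ.≤ e)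
          (seq-∑ (λ k → Li m (recip (suc k)) (∣recip∣≤1 (suc k))) (suc i) N)
          (proj₂ C-close N (ℕ.m⊔n≤o⇒n≤o Nγ NC N≥′))))
      where N≥′ = ℕ.m⊔n≤o⇒n≤o K (Nγ ℕ.⊔ NC) N≥

mainTheorem1 : (m : ℕ) .{{_ : NonTrivial m}} →
    ∑ (λ i → ((ζ (2+ i) - 1ℝ) / (2+ i ^ m)) {{m^n≢0 (2+ i) m}})
    ⟶ 1ℝ - γ - ζ m + C m
mainTheorem1 m ε 0<ε =
  -- The threshold `K`, with 1/(K+1) below ε/4, depends on `ε` alone, so the convergence is uniform
  -- in `m`.
  let 0<ε/4   = ½-pos (½-pos 0<ε)
      K , u<ε/4 = archimedean (½ ℚ.* (½ ℚ.* ε)) 0<ε/4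
  in K , partial-sum-near m 0<ε/4 K (quarters u<ε/4)
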